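{- For every vertex $s$ of $G$ we have the equality of formal power series \[\mathcal{B}(G,s;y)=\mathcal{P}(G,s;y)=(1-y)\,\mathcal{R}(G;y).\] Since the right-hand side is independent of $s$, the Biggs–Merino polynomial $\mathcal{B}(G,s;y)$ is independent of the choice of sink $s$ (conjecture of Perrot and Pham).
   Context: Let $G=(V,E)$ be a finite strongly connected digraph (loops and multiple edges allowed). Sinkless sandpile model: a chip configuration is $\mathbf{c}\in\mathbb{N}_0^V$; firing $v$ removes $\deg^+_G(v)$ chips from $v$ and sends one along each outgoing edge, legal if $\mathbf{c}(v)\ge\deg^+_G(v)$; $\mathbf{c}\rightsquigarrow\mathbf{d}$ means $\mathbf{d}$ is reached by finitely many legal firings. $\mathbf{c}$ is recurrent if unstable and $\mathbf{d}\rightsquigarrow\mathbf{c}$ whenever $\mathbf{c}\rightsquigarrow\mathbf{d}$; recurrent configurations are related by $\mathbf{c}\sim\mathbf{d}$ iff $\mathbf{c}\rightsquigarrow\mathbf{d}$. The level of a class is its number of chips; $\mathrm{Rec}_n(G,\sim)$ is the set of classes of level $n$ and $\mathcal{R}(G;y)=\sum_{n\ge0}|\mathrm{Rec}_n(G,\sim)|y^n$. Sandpile model with sink $s$: $s$-configurations $\widehat{\mathbf{c}}\in\mathbb{N}_0^{V\setminus\{s\}}$, $s$ never fires and chips sent to $s$ are lost; $\widehat{\mathbf{c}}^\circ$ is the stabilization; $\widehat{\mathbf{c}}$ is $s$-recurrent if for every $\widehat{\mathbf{c}}_1$ there is $\widehat{\mathbf{c}}_2$ with $(\widehat{\mathbf{c}}_1+\widehat{\mathbf{c}}_2)^\circ=\widehat{\mathbf{c}}$.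 With $\mathbf{u}_s(v)$ the number of edges $s\to v$, $\widehat{\mathbf{c}}\sim_s\widehat{\mathbf{d}}$ iff $\widehat{\mathbf{d}}=(\widehat{\mathbf{c}}+k\mathbf{u}_s)^\circ$ for some $k\in\mathbb{N}_0$; $\mathrm{Rec}(G,\sim_s)$ is the (finite) set of classes. Let $\overline{\mathbf{c}}$ extend $\widehat{\mathbf{c}}$ by $0$ at $s$, $\mathbf{1}_s$ the indicator of $s$, $\chi(\widehat{\mathbf{c}})$ the least $k$ with $\overline{\mathbf{c}}+k\mathbf{1}_s$ recurrent in the sinkless model, and $\mathrm{slvl}(\widehat{\mathbf{c}})=\chi(\widehat{\mathbf{c}})+\sum_{v\ne s}\widehat{\mathbf{c}}(v)$ (constant on classes); $\mathcal{P}(G,s;y)=\sum_{[\widehat{\mathbf{c}}]\in\mathrm{Rec}(G,\sim_s)}y^{\mathrm{slvl}([\widehat{\mathbf{c}}])}$. The d-level is $\mathrm{dlvl}(\widehat{\mathbf{c}})=\deg^+_G(s)+\sum_{v\ne s}\widehat{\mathbf{c}}(v)$, and of a class $\mathrm{dlvl}([\widehat{\mathbf{c}}])=\max_{\widehat{\mathbf{c}}'\in[\widehat{\mathbf{c}}]}\mathrm{dlvl}(\widehat{\mathbf{c}}')$. The Biggs–Merino polynomial is $\mathcal{B}(G,s;y)=\sum_{[\widehat{\mathbf{c}}]\in\mathrm{Rec}(G,\sim_s)}y^{\mathrm{dlvl}([\widehat{\mathbf{c}}])}$. -}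

module Defs where

open import Data.Nat using (ℕ; zero; suc; _+_; _*_; _∸_; _≤_; _<_)
open import Data.Fin using (Fin; _≟_)
open import Data.Vec using (Vec; lookup; tabulate; sum; zipWith; replicate; updateAt)
open import Data.Product using (Σ; ∃; ∃-syntax; _×_; _,_)
open import Data.Empty using (⊥)
open import Relation.Nullary using (¬_; yes; no)
open import Relation.Binary.PropositionalEquality using (_≡_)
open import Relation.Binary.Construct.Closure.ReflexiveTransitive using (Star)

-- A finite digraph on vertex set Fin n, given by edge multiplicities:
-- E u v = number of edges u → v (loops E v v and multi-edges allowed).

Digraph : ℕ → Set
Digraph n = Fin n → Fin n → ℕ

module _ {n : ℕ} (E : Digraph n) where

  data Path : Fin n → Fin n → Set where
    here : ∀ {u} → Path u u
    step : ∀ {u w v} → 0 < E u w → Path w v → Path u v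

  StronglyConnected : Set
  StronglyConnected = ∀ u v → Path u v

  outdeg : Fin n → ℕ
  outdeg v = sum (tabulate (E v))

  Config : Set
  Config = Vec ℕ n

  total : Config → ℕ
  total c = sum c

  -- result of firing v (the legality condition is imposed separately)
  fire : Config → Fin n → Config
  fire c v = tabulate λ w → f w
    where
    f : Fin n → ℕ
    f w with w ≟ v
    ... | yes _ = (lookup c v ∸ outdeg v) + E v v
    ... | no  _ = lookup c w + E v w

  Fires : Config → Config → Set
  Fires c d = ∃[ v ] (outdeg v ≤ lookup c v × d ≡ fire c v)

  _⇝_ : Config → Config → Set
  _⇝_ = Star Fires

  Unstable : Config → Set
  Unstable c = ∃[ v ] (outdeg v ≤ lookup c v)

  Recurrent : Config → Set
  Recurrent c = Unstable c × (∀ d → c ⇝ d → d ⇝ c)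

  -- equivalence of recurrent configurations
  _∼_ : Config → Config → Set
  c ∼ d = c ⇝ d

  -- Sandpile model with sink s.  An s-configuration is represented by a
  -- vector in ℕ^V whose s-entry is 0 (this vector is also the extension
  -- by 0 at s, written \overline{c} in the paper).

  module Sink (s : Fin n) where

    IsSConf : Config → Set
    IsSConf c = lookup c s ≡ 0

    sfire : Config → Fin n → Config
    sfire c v = tabulate λ w → f w
      where
      f : Fin n → ℕ
      f w with w ≟ s | w ≟ v
      ... | yes _ | _     = 0
      ... | no _  | yes _ = (lookup c v ∸ outdeg v) + E v v
      ... | no _  | no _  = lookup c w + E v w

    SFires : Config → Config → Set
    SFires c d = ∃[ v ] (¬ (v ≡ s) × outdeg v ≤ lookup c v × d ≡ sfire c v)

    _⇝s_ : Config → Config → Set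
    _⇝s_ = Star SFires

    SStable : Config → Set
    SStable c = ∀ v → ¬ (v ≡ s) → lookup c v < outdeg v

    Stabilizes : Config → Config → Set
    Stabilizes c d = c ⇝s d × SStable d

    _⊕_ : Config → Config → Config
    _⊕_ = zipWith _+_

    SRecurrent : Config → Set
    SRecurrent c = IsSConf c ×
      (∀ c₁ → IsSConf c₁ → ∃[ c₂ ] (IsSConf c₂ × Stabilizes (c₁ ⊕ c₂) c))

    us : Config
    us = tabulate λ w → f w
      where
      f : Fin n → ℕ
      f w with w ≟ s
      ... | yes _ = 0
      ... | no  _ = E s w

    scale : ℕ → Config → Config
    scale k c = zipWith _*_ (replicate n k) c

    _∼s_ : Config → Config → Set
    c ∼s d = ∃[ k ] Stabilizes (c ⊕ scale k us) d

    addSink : ℕ → Config → Config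
    addSink k c = updateAt c s (_+ k)

    IsChi : Config → ℕ → Set
    IsChi c k = Recurrent (addSink k c) × (∀ j → j < k → ¬ Recurrent (addSink j c))

    SLevel : Config → ℕ → Set
    SLevel c m = ∃[ k ] (IsChi c k × m ≡ k + total c)

    dlvl : Config → ℕ
    dlvl c = outdeg s + total c

    ClassDLevel : Config → ℕ → Set
    ClassDLevel c m =
      (∃[ c' ] (c ∼s c' × dlvl c' ≡ m)) × (∀ c' → c ∼s c' → dlvl c' ≤ m)

NumClasses : {A : Set} → (A → Set) → (A → A → Set) → ℕ → Set
NumClasses {A} R _≈_ k =
  Σ (Fin k → A) λ f →
    (∀ i → R (f i)) ×
    (∀ i j → f i ≈ f j → i ≡ j) ×
    (∀ a → R a → ∃[ i ] (f i ≈ a))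

module _ {n : ℕ} (E : Digraph n) where

  NumRec : ℕ → ℕ → Set
  NumRec m k = NumClasses (λ c → Recurrent E c × total E c ≡ m) (_∼_ E) k

  CoeffB : Fin n → ℕ → ℕ → Set
  CoeffB s m k = NumClasses (λ c → SRecurrent c × ClassDLevel c m) _∼s_ k
    where open Sink E s

  CoeffP : Fin n → ℕ → ℕ → Set
  CoeffP s m k = NumClasses (λ c → SRecurrent c × SLevel c m) _∼s_ k
    where open Sink E s

{-# OPTIONS --safe #-}
module Submission where

-- A configuration is recurrent iff some nonempty legal firing sequence returns to it, and by
-- strong connectivity such a cycle fires every vertex. An exchange argument (cancel the cycle
-- against the given firings) then shows that if c is recurrent, every nonnegative configuration obtained
-- from c by possibly illegal firings returns legally to c. Hence c ↦ c + 1_s is injective on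
-- recurrent classes, and (1 - y) R(G; y) counts the classes outside its image. Stabilizing such
-- a class off s leads to an s-recurrent configuration c with exactly χ(c) chips on s, which is
-- determined up to ∼s. Finally, let c be s-recurrent and fire s and stabilize off s repeatedly:
-- starting with χ(c) - 1 chips on s, the process halts at a member of the class of c with
-- deg s - 1 chips on s, so its d-level is slvl(c); starting with χ(c) chips it visits the whole
-- class and always finds at least deg s chips on s, so no d-level is larger.

open import Defs
open import Data.Nat using (ℕ; zero; suc; _+_; _*_; _∸_; _≤_; _<_; _^_; z≤n; s≤s; _≤?_)
open import Data.Nat.Properties hiding (_≟_)
open import Algebra.Properties.CommutativeSemigroup +-commutativeSemigroup using (interchange; xy∙z≈xz∙y; x∙yz≈xz∙y; xy∙z≈zy∙x; xy∙z≈x∙zy)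
open import Data.Nat.ListAction.Properties using (sum-↭)
import Data.Nat.ListAction as List
open import Data.Fin using (Fin; zero; suc; _≟_; toℕ; fromℕ<; splitAt; join; funToFin; finToFun)
open import Data.Fin.Properties using (any?; pigeonhole; injective⇒≤; finToFun-funToFin; fromℕ<-injective; splitAt-join; join-splitAt; toℕ<n)
open import Data.List using (List; []; _∷_; _++_; map; length; allFin)
open import Data.List.Membership.Propositional using (_∈_; _∉_)
open import Data.List.Membership.Propositional.Properties using (∈-∃++; ∈-allFin)
open import Data.List.Relation.Binary.Permutation.Propositional.Properties using (map⁺; shift; ↭-length)
open import Data.List.Relation.Unary.Any using (here; there)
open import Data.List.Relation.Unary.All as All using (All; []; _∷_)
open import Data.List.Relation.Unary.All.Properties using (++⁺)
open import Data.Vec using (lookup; tabulate; sum; updateAt; replicate)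
open import Data.Vec.Properties using (lookup∘tabulate; tabulate∘lookup; tabulate-cong; lookup-zipWith; lookup-replicate; lookup∘updateAt; lookup∘updateAt′)
open import Data.Product using (∃-syntax; _×_; _,_; proj₁; proj₂)
open import Data.Sum using (_⊎_; inj₁; inj₂)
open import Data.Empty using (⊥-elim)
open import Data.Unit using (⊤; tt)
open import Function using (_∘_; _∋_; case_of_)
open import Relation.Nullary using (¬_; yes; no)
open import Relation.Nullary.Decidable using (_×-dec_; ¬?)
open import Relation.Unary using (Decidable)
open import Relation.Binary.PropositionalEquality
open import Relation.Binary.Construct.Closure.ReflexiveTransitive using (ε; _◅_; _◅◅_)

-- Balance equations d + l ≡ c + g (chips lost l, chips gained g).

balance-trans : ∀ c d e l l' g g' → d + l ≡ c + g → e + l' ≡ d + g' → e + (l + l') ≡ c + (g + g')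
balance-trans c d e l l' g g' p q = begin
  e + (l + l')  ≡⟨ x∙yz≈xz∙y e l l' ⟩
  (e + l') + l  ≡⟨ cong (_+ l) q ⟩
  (d + g') + l  ≡⟨ xy∙z≈xz∙y d g' l ⟩
  (d + l) + g'  ≡⟨ cong (_+ g') p ⟩
  (c + g) + g'  ≡⟨ +-assoc c g g' ⟩
  c + (g + g')  ∎
  where open ≡-Reasoning

balance-cancel : ∀ c d e l l' g g' → d + l ≡ c + g → e + (l + l') ≡ c + (g + g') → e + l' ≡ d + g'
balance-cancel c d e l l' g g' p q = +-cancelʳ-≡ l (e + l') (d + g') (begin
  (e + l') + l  ≡⟨ x∙yz≈xz∙y e l l' ⟨
  e + (l + l')  ≡⟨ q ⟩
  c + (g + g')  ≡⟨ +-assoc c g g' ⟨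
  (c + g) + g'  ≡⟨ cong (_+ g') p ⟨
  (d + l) + g'  ≡⟨ xy∙z≈xz∙y d g' l ⟨
  (d + g') + l  ∎)
  where open ≡-Reasoning

balance-parallel : ∀ c c' d d' l l' g g' →
  c' + l ≡ c + g → d + l' ≡ c + g' → d' + l ≡ d + g → d' + l' ≡ c' + g'
balance-parallel c c' d d' l l' g g' p q r =
  balance-cancel c c' d' l l' g g' p (subst₂ (λ x y → d' + x ≡ c + y) (+-comm l' l) (+-comm g' g)
    (balance-trans c d d' l' l g' g q r))

-- Sums over the vertices.

tot : ∀ {n} → (Fin n → ℕ) → ℕ
tot f = sum (tabulate f)

tot-cong : ∀ {n} {f g : Fin n → ℕ} → f ≗ g → tot f ≡ tot g
tot-cong eq = cong sum (tabulate-cong eq)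

tot-+ : ∀ {n} (f g : Fin n → ℕ) → tot (λ w → f w + g w) ≡ tot f + tot g
tot-+ {zero}  f g = refl
tot-+ {suc n} f g = trans (cong (f zero + g zero +_) (tot-+ (f ∘ suc) (g ∘ suc)))
  (interchange (f zero) (g zero) (tot (f ∘ suc)) (tot (g ∘ suc)))

tot-0 : ∀ n → tot {n} (λ _ → 0) ≡ 0
tot-0 zero    = refl
tot-0 (suc n) = tot-0 n

≤-tot : ∀ {n} (f : Fin n → ℕ) w → f w ≤ tot f
≤-tot f zero    = m≤m+n _ _
≤-tot f (suc w) = ≤-trans (≤-tot (f ∘ suc) w) (m≤n+m _ (f zero))

tot-mono-≤ : ∀ {n} {f g : Fin n → ℕ} → (∀ w → f w ≤ g w) → tot f ≤ tot g
tot-mono-≤ {zero}  p = z≤n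
tot-mono-≤ {suc n} p = +-mono-≤ (p zero) (tot-mono-≤ (p ∘ suc))

tot-mono-< : ∀ {n} {f g : Fin n → ℕ} → Fin n → (∀ w → f w < g w) → tot f < tot g
tot-mono-< {suc n} _ p = +-mono-<-≤ (p zero) (tot-mono-≤ (λ w → <⇒≤ (p (suc w))))

tot-change : ∀ {n} {f g : Fin n → ℕ} s → (∀ w → w ≢ s → f w ≡ g w) → tot f + g s ≡ tot g + f s
tot-change {f = f} {g} zero p = begin
  (f zero + tot (f ∘ suc)) + g zero ≡⟨ cong (λ x → f zero + x + g zero) (tot-cong (λ w → p (suc w) λ ())) ⟩
  (f zero + tot (g ∘ suc)) + g zero ≡⟨ xy∙z≈zy∙x (f zero) _ (g zero) ⟩
  (g zero + tot (g ∘ suc)) + f zero ∎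
  where open ≡-Reasoning
tot-change {f = f} {g} (suc s) p = begin
  (f zero + tot (f ∘ suc)) + g (suc s) ≡⟨ +-assoc (f zero) _ _ ⟩
  f zero + (tot (f ∘ suc) + g (suc s)) ≡⟨ cong₂ _+_ (p zero λ ()) (tot-change s (λ w w≢s → p (suc w) (λ { refl → w≢s refl }))) ⟩
  g zero + (tot (g ∘ suc) + f (suc s)) ≡⟨ +-assoc (g zero) _ _ ⟨
  (g zero + tot (g ∘ suc)) + f (suc s) ∎
  where open ≡-Reasoning

-- Chips lost and gained by a list of firings.

module Firing {n : ℕ} (E : Digraph n) where

  open import Data.List.Membership.DecPropositional (_≟_ {n}) using (_∈?_)

  Conf : Set
  Conf = Fin n → ℕ

  deg : Fin n → ℕ
  deg = outdeg E

  _⊞_ : Conf → Conf → Conf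
  (c ⊞ d) w = c w + d w

  _·_ : ℕ → Conf → Conf
  (k · c) w = k * c w

  infixl 6 _⊞_
  infixl 7 _·_

  -- A firing is split into a payment and a receipt, a loop being counted in both; this keeps the
  -- balance equations free of subtraction.
  cost : Fin n → Fin n → ℕ
  cost v w with w ≟ v
  ... | yes _ = deg v
  ... | no  _ = 0

  cost-≡ : ∀ v → cost v v ≡ deg v
  cost-≡ v with v ≟ v
  ... | yes _   = refl
  ... | no  v≢v = ⊥-elim (v≢v refl)

  cost-≢ : ∀ {v w} → w ≢ v → cost v w ≡ 0
  cost-≢ {v} {w} w≢v with w ≟ v
  ... | yes w≡v = ⊥-elim (w≢v w≡v)
  ... | no  _   = refl

  cost-≤ : ∀ {c : Conf} {v} → deg v ≤ c v → ∀ w → cost v w ≤ c w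
  cost-≤ {v = v} legal w with w ≟ v
  ... | yes refl = legal
  ... | no  _    = z≤n

  tot-cost : ∀ v → tot (cost v) ≡ deg v
  tot-cost v = begin
    tot (cost v)          ≡⟨ +-identityʳ _ ⟨
    tot (cost v) + 0      ≡⟨ tot-change v (λ w → cost-≢) ⟩
    tot {n} (λ _ → 0) + cost v v ≡⟨ cong₂ _+_ (tot-0 n) (cost-≡ v) ⟩
    deg v                 ∎
    where open ≡-Reasoning

  loss gain : List (Fin n) → Conf
  loss σ w = List.sum (map (λ v → cost v w) σ)
  gain σ w = List.sum (map (λ v → E v w) σ)

  loss-∉ : ∀ {w} σ → w ∉ σ → loss σ w ≡ 0
  loss-∉ []      _   = refl
  loss-∉ (v ∷ σ) w∉σ = cong₂ _+_ (cost-≢ (w∉σ ∘ here)) (loss-∉ σ (w∉σ ∘ there))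

  loss-deg0 : ∀ {w} σ → deg w ≡ 0 → loss σ w ≡ 0
  loss-deg0 {w} []      _     = refl
  loss-deg0 {w} (v ∷ σ) deg≡0 = cong₂ _+_ cost≡0 (loss-deg0 σ deg≡0)
    where
    cost≡0 : cost v w ≡ 0
    cost≡0 with w ≟ v
    ... | yes refl = deg≡0
    ... | no  _    = refl

  gain-∈ : ∀ {v w σ} → v ∈ σ → E v w ≤ gain σ w
  gain-∈ (here refl) = m≤m+n _ _
  gain-∈ (there p)   = ≤-trans (gain-∈ p) (m≤n+m _ _)

  tot-loss≡tot-gain : ∀ σ → tot (loss σ) ≡ tot (gain σ)
  tot-loss≡tot-gain []      = refl
  tot-loss≡tot-gain (v ∷ σ) = begin
    tot (loss (v ∷ σ))          ≡⟨ tot-+ (cost v) (loss σ) ⟩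
    tot (cost v) + tot (loss σ) ≡⟨ cong₂ _+_ (tot-cost v) (tot-loss≡tot-gain σ) ⟩
    tot (E v) + tot (gain σ)    ≡⟨ tot-+ (E v) (gain σ) ⟨
    tot (gain (v ∷ σ))          ∎
    where open ≡-Reasoning

  after : Conf → Fin n → Conf
  after c v w = (c w + E v w) ∸ cost v w

  after-balance : ∀ {c : Conf} {v} → deg v ≤ c v → ∀ w → after c v w + cost v w ≡ c w + E v w
  after-balance {c} legal w = m∸n+n≡m (≤-trans (cost-≤ {c} legal w) (m≤m+n _ _))

  -- Only the vertices in P may fire, and chips outside P are ignored.
  -- Taking P to be everything gives the sinkless model, and P = (_≢ s) the model with sink s.

  module Legal (P : Fin n → Set) where

    infix 4 _≈_ _⟶_

    _≈_ : Conf → Conf → Set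
    c ≈ d = ∀ w → P w → c w ≡ d w

    record Step (c : Conf) (v : Fin n) (d : Conf) : Set where
      constructor step
      field at : ∀ w → P w → d w + cost v w ≡ c w + E v w

    -- Only the number of firings of each vertex enters, so this describes `σ` carried out in any
    -- order and without regard to legality.
    record Balanced (c : Conf) (σ : List (Fin n)) (d : Conf) : Set where
      constructor balanced
      field at : ∀ w → P w → d w + loss σ w ≡ c w + gain σ w

    open Step
    open Balanced

    -- Legal runs and the abelian property.

    data Run : Conf → List (Fin n) → Conf → Set where
      done : ∀ {c d} → c ≈ d → Run c [] d
      next : ∀ {c d e v σ} → P v → deg v ≤ c v → Step c v d → Run d σ e → Run c (v ∷ σ) e

    _⟶_ : Conf → Conf → Set
    c ⟶ d = ∃[ σ ] Run c σ d

    Stable : Conf → Set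
    Stable c = ∀ v → P v → c v < deg v

    run-balanced : ∀ {c σ d} → Run c σ d → Balanced c σ d
    run-balanced (done eq) .at w Pw = cong (_+ 0) (sym (eq w Pw))
    run-balanced {c} {v ∷ σ} {d} (next {d = c'} _ _ st r) .at w Pw =
      balance-trans (c w) (c' w) (d w) (cost v w) (loss σ w) (E v w) (gain σ w) (st .at w Pw) (run-balanced r .at w Pw)

    step-resp : ∀ {c c' v d d'} → c ≈ c' → d ≈ d' → Step c v d → Step c' v d'
    step-resp c≈ d≈ st .at w Pw =
      trans (cong (_+ _) (sym (d≈ w Pw))) (trans (st .at w Pw) (cong (_+ _) (c≈ w Pw)))

    step-unique : ∀ {c v d d'} → Step c v d → Step c v d' → d ≈ d'
    step-unique {v = v} st st' w Pw = +-cancelʳ-≡ (cost v w) _ _ (trans (st .at w Pw) (sym (st' .at w Pw)))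

    run-resp : ∀ {c c' σ d d'} → c ≈ c' → d ≈ d' → Run c σ d → Run c' σ d'
    run-resp c≈ d≈ (done eq) = done λ w Pw → trans (sym (c≈ w Pw)) (trans (eq w Pw) (d≈ w Pw))
    run-resp c≈ d≈ (next Pv legal st r) =
      next Pv (subst (_ ≤_) (c≈ _ Pv) legal) (step-resp c≈ (λ _ _ → refl) st) (run-resp (λ _ _ → refl) d≈ r)

    ⟶-resp : ∀ {c c' d d'} → c ≈ c' → d ≈ d' → c ⟶ d → c' ⟶ d'
    ⟶-resp c≈ d≈ (σ , r) = σ , run-resp c≈ d≈ r

    ⟶-refl : ∀ {c} → c ⟶ c
    ⟶-refl = [] , done λ _ _ → refl

    run-++ : ∀ {c σ d τ e} → Run c σ d → Run d τ e → Run c (σ ++ τ) e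
    run-++ (done eq)            r' = run-resp (λ w Pw → sym (eq w Pw)) (λ _ _ → refl) r'
    run-++ (next Pv legal st r) r' = next Pv legal st (run-++ r r')

    ⟶-trans : ∀ {c d e} → c ⟶ d → d ⟶ e → c ⟶ e
    ⟶-trans (σ , r) (τ , r') = σ ++ τ , run-++ r r'

    run-⊞ : ∀ {c σ d} x → Run c σ d → Run (c ⊞ x) σ (d ⊞ x)
    run-⊞ x (done eq) = done λ w Pw → cong (_+ x w) (eq w Pw)
    run-⊞ {c} x (next {d = d} {v = v} Pv legal st r) = next Pv (≤-trans legal (m≤m+n _ _))
      (step λ w Pw → begin
        d w + x w + cost v w  ≡⟨ xy∙z≈xz∙y (d w) (x w) (cost v w) ⟩
        d w + cost v w + x w  ≡⟨ cong (_+ x w) (st .at w Pw) ⟩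
        c w + E v w + x w     ≡⟨ xy∙z≈xz∙y (c w) (E v w) (x w) ⟩
        c w + x w + E v w     ∎)
      (run-⊞ x r)
      where open ≡-Reasoning

    ⟶-⊞ : ∀ {c d} x → c ⟶ d → c ⊞ x ⟶ d ⊞ x
    ⟶-⊞ x (σ , r) = σ , run-⊞ x r

    ⟶-⊞-⟶ : ∀ {c c' d d'} → c ⟶ c' → d ⟶ d' → c ⊞ d ⟶ c' ⊞ d'
    ⟶-⊞-⟶ {c} {c'} {d} {d'} p q = ⟶-trans (⟶-⊞ d p)
      (⟶-resp (λ w _ → +-comm (d w) (c' w)) (λ w _ → +-comm (d' w) (c' w)) (⟶-⊞ c' q))

    ⟶-· : ∀ {c d} k → c ⟶ d → k · c ⟶ k · d
    ⟶-· zero    p = ⟶-refl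
    ⟶-· (suc k) p = ⟶-⊞-⟶ p (⟶-· k p)

    fire-one : ∀ {c v} → P v → deg v ≤ c v → c ⟶ after c v
    fire-one Pv legal = _ , next Pv legal (step λ w _ → after-balance legal w) (done λ _ _ → refl)

    stable-⟶ : ∀ {c d} → Stable c → c ⟶ d → c ≈ d
    stable-⟶ st ([]    , done eq)          = eq
    stable-⟶ st (v ∷ σ , next Pv legal _ _) = ⊥-elim (<⇒≱ (st v Pv) legal)

    -- Executing the legal run τ from a configuration that already has performed
    -- (possibly illegally) the firings σ: each firing of τ is either cancelled
    -- against one of σ, or is legal because σ can only have added chips there.

    exchange : ∀ {c τ e σ d} → Run c τ e → Balanced c σ d →
      ∃[ σ' ] ∃[ g ] (d ⟶ g × Balanced e σ' g × length σ' ≤ length σ ×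
        (∀ {w} → w ∈ σ → w ∈ τ → length σ' < length σ))
    exchange {σ = σ} {d} (done eq) b =
      σ , d , ⟶-refl , balanced (λ w Pw → trans (b .at w Pw) (cong (_+ _) (eq w Pw))) , ≤-refl , λ _ ()
    exchange {c} {v ∷ τ} {e} {σ} {d} (next {d = c'} Pv legal st r) b with v ∈? σ
    ... | yes v∈σ with xs , ys , refl ← ∈-∃++ v∈σ =
      let
        perm = shift v xs ys
        b' : Balanced c' (xs ++ ys) d
        b' = balanced λ w Pw → balance-cancel (c w) (c' w) (d w) (cost v w) (loss (xs ++ ys) w) (E v w) (gain (xs ++ ys) w) (st .at w Pw)
          (subst₂ (λ x y → d w + x ≡ c w + y) (sum-↭ (map⁺ (λ u → cost u w) perm)) (sum-↭ (map⁺ (λ u → E u w) perm)) (b .at w Pw))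
        σ' , g , run , bal , len , _ = exchange r b'
        len< = ≤-trans (s≤s len) (≤-reflexive (sym (↭-length perm)))
      in σ' , g , run , bal , <⇒≤ len< , λ _ _ → len<
    ... | no v∉σ =
      let
        open ≤-Reasoning
        legal' : deg v ≤ d v
        legal' = begin
          deg v          ≤⟨ legal ⟩
          c v            ≤⟨ m≤m+n _ _ ⟩
          c v + gain σ v ≡⟨ b .at v Pv ⟨
          d v + loss σ v ≡⟨ cong (d v +_) (loss-∉ σ v∉σ) ⟩
          d v + 0        ≡⟨ +-identityʳ _ ⟩
          d v            ∎
        b' : Balanced c' σ (after d v)
        b' = balanced λ w Pw → balance-parallel (c w) (c' w) (d w) (after d v w) (cost v w) (loss σ w) (E v w) (gain σ w)
          (st .at w Pw) (b .at w Pw) (after-balance legal' w)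
        σ' , g , run , bal , len , len< = exchange r b'
      in σ' , g , ⟶-trans (fire-one Pv legal') run , bal , len ,
         λ { w∈σ (here refl) → ⊥-elim (v∉σ w∈σ) ; w∈σ (there w∈τ) → len< w∈σ w∈τ }

    -- If `τ` did not fire `v`, then `v` could still fire at `e`. So `exchange` against the single
    -- firing `v` strictly shortens that list, leaving nothing between `e` and the configuration
    -- reached from `d`.
    ⟶-stable-step : ∀ {c v d e} → P v → deg v ≤ c v → Step c v d → c ⟶ e → Stable e → d ⟶ e
    ⟶-stable-step {c} {v} {d} {e} Pv legal st (τ , r) stable with v ∈? τ
    ... | no v∉τ = ⊥-elim (<⇒≱ (stable v Pv) (begin
      deg v          ≤⟨ legal ⟩
      c v            ≤⟨ m≤m+n _ _ ⟩
      c v + gain τ v ≡⟨ run-balanced r .at v Pv ⟨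
      e v + loss τ v ≡⟨ cong (e v +_) (loss-∉ τ v∉τ) ⟩
      e v + 0        ≡⟨ +-identityʳ _ ⟩
      e v            ∎))
      where open ≤-Reasoning
    ... | yes v∈τ with exchange r (run-balanced (next {σ = []} Pv legal st (done λ _ _ → refl)))
    ...   | [] , g , run , bal , _ , _ = ⟶-resp (λ _ _ → refl) (λ w Pw → +-cancelʳ-≡ 0 _ _ (bal .at w Pw)) run
    ...   | _ ∷ _ , _ , _ , _ , _ , len< with s≤s () ← len< (here refl) v∈τ

    ⟶-stable : ∀ {c d e} → c ⟶ d → c ⟶ e → Stable e → d ⟶ e
    ⟶-stable ([]    , done eq)            q stable = ⟶-resp eq (λ _ _ → refl) q
    ⟶-stable (v ∷ σ , next Pv legal st r) q stable =
      ⟶-stable (σ , r) (⟶-stable-step Pv legal st q stable) stable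

    stabilization-unique : ∀ {c d e} → c ⟶ d → Stable d → c ⟶ e → Stable e → d ≈ e
    stabilization-unique p std q ste = stable-⟶ std (⟶-stable p q ste)

-- Recurrence in the sinkless model.

Everywhere : ∀ {n} → Fin n → Set
Everywhere _ = ⊤

Off : ∀ {n} → Fin n → Fin n → Set
Off s w = w ≢ s

module Recurrence {n : ℕ} (E : Digraph n) (connected : StronglyConnected E) where

  open Firing E
  open Legal Everywhere public
  open Legal.Step
  open Legal.Balanced
  open import Data.List.Membership.DecPropositional (_≟_ {n}) using (_∈?_)

  ⟶-tot : ∀ {c d} → c ⟶ d → tot c ≡ tot d
  ⟶-tot {c} {d} (σ , r) = +-cancelʳ-≡ (tot (gain σ)) (tot c) (tot d) (begin
    tot c + tot (gain σ)          ≡⟨ tot-+ c (gain σ) ⟨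
    tot (c ⊞ gain σ)              ≡⟨ tot-cong (λ w → run-balanced r .at w tt) ⟨
    tot (d ⊞ loss σ)              ≡⟨ tot-+ d (loss σ) ⟩
    tot d + tot (loss σ)          ≡⟨ cong (tot d +_) (tot-loss≡tot-gain σ) ⟩
    tot d + tot (gain σ)          ∎)
    where open ≡-Reasoning

  -- The working form of recurrence: unlike `Recurrent`, it is visibly preserved when chips are
  -- added (`cyclic-⊞`).
  Cyclic : Conf → Set
  Cyclic c = ∃[ v ] ∃[ τ ] Run c (v ∷ τ) c

  cyclic-unstable : ∀ {c} → Cyclic c → ∃[ v ] deg v ≤ c v
  cyclic-unstable (v , _ , next _ legal _ _) = v , legal

  stable-not-cyclic : ∀ {c} → Stable c → ¬ Cyclic c
  stable-not-cyclic stable cyc with v , legal ← cyclic-unstable cyc = <⇒≱ (stable v tt) legal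

  cyclic-⊞ : ∀ {c} x → Cyclic c → Cyclic (c ⊞ x)
  cyclic-⊞ x (v , τ , r) = v , τ , run-⊞ x r

  cyclic-resp : ∀ {c d} → c ≈ d → Cyclic c → Cyclic d
  cyclic-resp eq (v , τ , r) = v , τ , run-resp eq eq r

  -- Around a cycle every vertex loses exactly what it gains, so a vertex that is sent a chip has to
  -- fire.
  cycle-edge : ∀ {c τ v w} → Run c τ c → v ∈ τ → 0 < E v w → w ∈ τ
  cycle-edge {c} {τ} {v} {w} r v∈τ e with w ∈? τ
  ... | yes w∈τ = w∈τ
  ... | no  w∉τ = ⊥-elim (<⇒≱ e (begin
    E v w     ≤⟨ gain-∈ v∈τ ⟩
    gain τ w  ≡⟨ +-cancelˡ-≡ (c w) (gain τ w) 0 (trans (sym (run-balanced r .at w tt)) (cong (c w +_) (loss-∉ τ w∉τ))) ⟩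
    0         ∎))
    where open ≤-Reasoning

  cycle-path : ∀ {c τ v w} → Run c τ c → v ∈ τ → Path E v w → w ∈ τ
  cycle-path r v∈τ Path.here       = v∈τ
  cycle-path r v∈τ (Path.step e p) = cycle-path r (cycle-edge r v∈τ e) p

  cycle-full : ∀ {c v τ} → Run c (v ∷ τ) c → ∀ w → w ∈ v ∷ τ
  cycle-full r w = cycle-path r (here refl) (connected _ w)

  -- Going once around the cycle cancels at least one firing of σ.

  return : ∀ {e σ d} → Cyclic e → Balanced e σ d → d ⟶ e
  return {e} {σ} (v , τ , r) b = go (length σ) ≤-refl b
    where
    go : ∀ {σ d} k → length σ ≤ k → Balanced e σ d → d ⟶ e
    go {[]} k _ b = [] , done λ w p → +-cancelʳ-≡ 0 _ _ (b .at w p)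
    go {u ∷ σ} (suc k) len b with exchange r b
    ... | σ' , g , run , b' , _ , len< =
      ⟶-trans run (go k (≤-pred (≤-trans (len< (here refl) (cycle-full r u)) len)) b')

  ⟶-sym : ∀ {c d} → Cyclic c → c ⟶ d → d ⟶ c
  ⟶-sym cyc (σ , r) = return cyc (run-balanced r)

  nonempty-cyclic : ∀ {c v τ} ρ → Run c (ρ ++ v ∷ τ) c → Cyclic c
  nonempty-cyclic []      r = _ , _ , r
  nonempty-cyclic (_ ∷ _) r = _ , _ , r

  -- Go back to `c`, once around its cycle and forward again; the middle part keeps the loop
  -- nonempty even if the outer runs are empty.
  cyclic-⟶ : ∀ {c d} → Cyclic c → c ⟶ d → Cyclic d
  cyclic-⟶ cyc@(v , τ , r) p@(_ , r') with ρ , r'' ← ⟶-sym cyc p =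
    nonempty-cyclic ρ (run-++ r'' (run-++ r r'))

  -- Without the chips `x` the run may be illegal, but its balance survives the cancellation of `x`,
  -- and `return` asks for no more. This is the source of the injectivity of adding a chip.
  return-⊞ : ∀ {c d} x → Cyclic c → c ⊞ x ⟶ d ⊞ x → d ⟶ c
  return-⊞ {c} {d} x cyc (σ , r) = return {σ = σ} cyc (balanced λ w p → +-cancelʳ-≡ (x w) _ _ (begin
    d w + loss σ w + x w  ≡⟨ xy∙z≈xz∙y (d w) (loss σ w) (x w) ⟩
    d w + x w + loss σ w  ≡⟨ run-balanced r .at w p ⟩
    c w + x w + gain σ w  ≡⟨ xy∙z≈xz∙y (c w) (x w) (gain σ w) ⟩
    c w + gain σ w + x w  ∎))
    where open ≡-Reasoning

  -- With the number of chips fixed there are finitely many configurations, so greedy firing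
  -- of the vertices in Q either stops or enters a cycle.

  module Greedy {Q : Fin n → Set} (Q? : Decidable Q) where

    Fireable : Conf → Set
    Fireable c = ∃[ v ] (Q v × deg v ≤ c v)

    fireable? : Decidable Fireable
    fireable? c = any? λ v → Q? v ×-dec (deg v ≤? c v)

    move : Conf → Conf
    move c with fireable? c
    ... | yes (v , _) = after c v
    ... | no  _       = c

    move-run : ∀ c → ∃[ σ ] (Run c σ (move c) × All Q σ × (Fireable c → σ ≢ []))
    move-run c with fireable? c
    ... | yes (v , Qv , legal) = v ∷ [] , proj₂ (fire-one tt legal) , Qv ∷ [] , λ _ ()
    ... | no  stuck            = [] , done (λ _ _ → refl) , [] , λ f → ⊥-elim (stuck f)

    orbit : Conf → ℕ → Conf
    orbit c zero    = c
    orbit c (suc k) = orbit (move c) k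

    orbit-run : ∀ c k → ∃[ σ ] (Run c σ (orbit c k) × All Q σ)
    orbit-run c zero    = [] , done (λ _ _ → refl) , []
    orbit-run c (suc k) with move-run c | orbit-run (move c) k
    ... | σ , r , q , _ | τ , r' , q' = σ ++ τ , run-++ r r' , ++⁺ q q'

    orbit-stops : ∀ c k → (∃[ j ] ¬ Fireable (orbit c j)) ⊎ (∀ i → i < k → Fireable (orbit c i))
    orbit-stops c zero    = inj₂ λ _ ()
    orbit-stops c (suc k) with fireable? (orbit c k) | orbit-stops c k
    ... | no  stuck | _             = inj₁ (k , stuck)
    ... | yes _     | inj₁ stop     = inj₁ stop
    ... | yes f     | inj₂ continue = inj₂ λ i i<1+k → case m≤n⇒m<n∨m≡n (≤-pred i<1+k) of λ
      { (inj₁ i<k) → continue i i<k ; (inj₂ refl) → f }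

    orbit-+ : ∀ c i k → orbit c (i + k) ≡ orbit (orbit c i) k
    orbit-+ c zero    k = refl
    orbit-+ c (suc i) k = orbit-+ (move c) i k

    -- Each entry is at most the conserved total `tot c`, so a configuration is a word of length `n`
    -- in `suc (tot c)` letters. The bound on `j` places `i` within the range searched by
    -- `orbit-stops`.
    orbit-repeats : ∀ c → ∃[ i ] ∃[ j ] (i < j × j ≤ suc (tot c) ^ n × orbit c i ≈ orbit c j)
    orbit-repeats c with pigeonhole (n<1+n (suc (tot c) ^ n)) (λ i → code (toℕ i))
      where
      bound : ∀ i w → orbit c i w < suc (tot c)
      bound i w with σ , r , _ ← orbit-run c i =
        s≤s (≤-trans (≤-tot (orbit c i) w) (≤-reflexive (sym (⟶-tot (σ , r)))))
      code : ℕ → Fin (suc (tot c) ^ n)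
      code i = funToFin λ w → fromℕ< (bound i w)
    ... | i , j , i<j , eq = toℕ i , toℕ j , i<j , ≤-pred (toℕ<n j) , λ w _ →
      fromℕ<-injective _ _ _ _ (trans (sym (finToFun-funToFin _ w)) (trans (cong (λ x → finToFun x w) eq) (finToFun-funToFin _ w)))

    -- A stuck orbit repeats trivially, since `move` is then the identity; fireability at `i` makes
    -- the loop nonempty.
    orbit-cycle : ∀ c {i j} → Fireable (orbit c i) → i < j → orbit c i ≈ orbit c j →
      ∃[ d ] ∃[ v ] ∃[ τ ] (Run d (v ∷ τ) d × All Q (v ∷ τ))
    orbit-cycle c {i} f i<j eq with k , refl ← m≤n⇒∃[o]m+o≡n i<j
      with move-run (orbit c i) | orbit-run (move (orbit c i)) k
    ... | [] , _ , _ , nonempty | _ = ⊥-elim (nonempty f refl)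
    ... | v ∷ σ , r , q , _ | τ , r' , q' =
      orbit c i , v , σ ++ τ , run-resp (λ _ _ → refl) back (run-++ r r') , ++⁺ q q'
      where
      back : orbit (orbit c i) (suc k) ≈ orbit c i
      back w p = trans (cong (λ d → d w) (trans (sym (orbit-+ c i (suc k))) (cong (orbit c) (+-suc i k)))) (sym (eq w p))

    abstract
      settle : ∀ c → (∃[ σ ] ∃[ d ] (Run c σ d × All Q σ × Legal.Stable Q d)) ⊎
                     (∃[ d ] ∃[ v ] ∃[ τ ] (Run d (v ∷ τ) d × All Q (v ∷ τ)))
      settle c with orbit-stops c (suc (tot c) ^ n)
      ... | inj₁ (j , stuck) =
        let σ , r , q = orbit-run c j
        in inj₁ (σ , orbit c j , r , q , λ v Qv → ≰⇒> λ legal → stuck (v , Qv , legal))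
      ... | inj₂ continue =
        let i , j , i<j , j≤ , eq = orbit-repeats c
        in inj₂ (orbit-cycle c (continue i (≤-trans i<j j≤)) i<j eq)

-- The model with sink compared with the sinkless one.

module WithSink {n : ℕ} (E : Digraph n) (connected : StronglyConnected E) (s : Fin n) where

  open Firing E
  open Recurrence E connected
  open Legal.Step
  module S = Legal (Off s)

  u : Conf
  u = E s

  sum-⊞ : ∀ c j k → c ⊞ (j + k) · u S.≈ c ⊞ j · u ⊞ k · u
  sum-⊞ c j k w _ = trans (cong (c w +_) (*-distribʳ-+ (u w) j k)) (sym (+-assoc (c w) _ _))

  ≈-extend : ∀ {c d} → c S.≈ d → tot c ≡ tot d → c ≈ d
  ≈-extend {c} {d} eq tot≡ w _ with w ≟ s
  ... | no  w≢s  = eq w w≢s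
  ... | yes refl = +-cancelˡ-≡ (tot d) (c w) (d w)
    (trans (sym (tot-change s eq)) (cong (_+ d w) tot≡))

  restrict : ∀ {c σ d} → Run c σ d → All (Off s) σ → S.Run c σ d
  restrict (done eq) [] = S.done λ w _ → eq w tt
  restrict (next _ legal st r) (v≢s ∷ q) = S.next v≢s legal (S.step λ w _ → st .at w tt) (restrict r q)

  -- A cycle would have to fire `s` by `cycle-full`, so greedy firing off `s` stops. The same run is
  -- recorded in both models.
  stabilize : ∀ c → ∃[ σ ] ∃[ d ] (Run c σ d × S.Run c σ d × S.Stable d)
  stabilize c with Greedy.settle (λ w → ¬? (w ≟ s)) c
  ... | inj₁ (σ , d , r , q , stable) = σ , d , r , restrict r q , stable
  ... | inj₂ (_ , _ , _ , r , q)      = ⊥-elim (All.lookup q (cycle-full r s) refl)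

  stable-tot : ∀ {c} → Stable c → tot c < tot deg
  stable-tot stable = tot-mono-< s λ w → stable w tt

  -- The configuration `deg` has as many chips as there are edges, one too many for a stable
  -- configuration, and chips are conserved.
  cyclic-exists : ∃[ c ] Cyclic c
  cyclic-exists with Greedy.settle (λ _ → yes tt) deg
  ... | inj₁ (σ , d , r , _ , stable) = ⊥-elim (<-irrefl (sym (⟶-tot (σ , r))) (stable-tot stable))
  ... | inj₂ (d , v , τ , r , _)      = d , v , τ , r

  step-sink : ∀ {c d} → Step c s d → c ⊞ 1 · u S.≈ d
  step-sink {c} {d} st w w≢s = begin
    c w + 1 * E s w  ≡⟨ cong (c w +_) (*-identityˡ _) ⟩
    c w + E s w      ≡⟨ st .at w tt ⟨
    d w + cost s w   ≡⟨ cong (d w +_) (cost-≢ w≢s) ⟩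
    d w + 0          ≡⟨ +-identityʳ _ ⟩
    d w              ∎
    where open ≡-Reasoning

  -- Firing the sink amounts to adding u, and these additions can all be made at the start.

  project : ∀ {c σ d} → Run c σ d → ∃[ j ] (c ⊞ j · u S.⟶ d × (s ∈ σ → 1 ≤ j))
  project {c} (done eq) = 0 , ([] , S.done λ w _ → trans (+-identityʳ _) (eq w tt)) , λ ()
  project {c} {v ∷ _} (next {d = c'} _ legal st r) with project r | v ≟ s
  ... | j , p , s∈ | yes refl = suc j , S.⟶-resp eq (λ _ _ → refl) p , λ _ → s≤s z≤n
    where
    eq : c' ⊞ j · u S.≈ c ⊞ suc j · u
    eq w w≢s = trans (cong (_+ j * u w) (sym (step-sink {c} {c'} st w w≢s))) (sym (sum-⊞ c 1 j w w≢s))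
  ... | j , p , s∈ | no v≢s = j ,
    S.⟶-trans (S.⟶-⊞ (j · u) (_ , S.next v≢s legal (S.step λ w _ → st .at w tt) (S.done λ _ _ → refl))) p ,
    λ { (here refl) → ⊥-elim (v≢s refl) ; (there q) → s∈ q }

  -- A burning test: the trace of `Cyclic` off the sink, with `k` standing for the number of firings
  -- of `s`. For stable configurations it is equivalent to `Absorbing`, as shown below.
  SinkCyclic : Conf → Set
  SinkCyclic c = ∃[ k ] (1 ≤ k × c ⊞ k · u S.⟶ c)

  sinkCyclic-resp : ∀ {c d} → c S.≈ d → SinkCyclic c → SinkCyclic d
  sinkCyclic-resp eq (k , 1≤k , p) =
    k , 1≤k , S.⟶-resp (λ w w≢s → cong (_+ k * u w) (eq w w≢s)) eq p

  cyclic⇒sinkCyclic : ∀ {c} → Cyclic c → SinkCyclic c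
  cyclic⇒sinkCyclic (v , τ , r) with j , p , s∈ ← project r = j , s∈ (cycle-full r s) , p

  Fillable : Fin n → Set
  Fillable w = ∃[ k ] ∃[ g ] (k · u S.⟶ g × 1 ≤ g w)

  -- If `k · u` can put a chip on `v`, then `deg v` superposed copies make `v` fireable, and its
  -- firing puts a chip on `w`.
  fill-edge : ∀ {v w} → v ≡ s ⊎ Fillable v → 0 < E v w → w ≡ s ⊎ Fillable w
  fill-edge {v} {w} reach e with v ≟ s | reach
  ... | yes refl | _        = inj₂ (1 , 1 · u , S.⟶-refl , ≤-trans e (≤-reflexive (sym (*-identityˡ _))))
  ... | no v≢s   | inj₁ v≡s = ⊥-elim (v≢s v≡s)
  ... | no v≢s   | inj₂ (k , g , p , 1≤g) = inj₂ (deg v * k , after c v ,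
      S.⟶-trans (S.⟶-resp (λ w _ → sym (*-assoc (deg v) k (u w))) (λ _ _ → refl) (S.⟶-· (deg v) p)) (S.fire-one v≢s legal) ,
      ≤-trans e (m+n≤o⇒m≤o∸n (E v w) (≤-trans (+-monoʳ-≤ (E v w) (cost-≤ {c} legal w)) (≤-reflexive (+-comm (E v w) (c w))))))
    where
    c : Conf
    c = deg v · g
    legal : deg v ≤ c v
    legal = ≤-trans (≤-reflexive (sym (*-identityʳ _))) (*-monoʳ-≤ (deg v) 1≤g)

  fill-path : ∀ {v w} → v ≡ s ⊎ Fillable v → Path E v w → w ≡ s ⊎ Fillable w
  fill-path reach Path.here       = reach
  fill-path reach (Path.step e p) = fill-path (fill-edge reach e) p

  fill-all : ∀ vs → ∃[ k ] ∃[ g ] (k · u S.⟶ g × (∀ {v} → v ∈ vs → v ≢ s → 1 ≤ g v))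
  fill-all []       = 0 , 0 · u , S.⟶-refl , λ ()
  fill-all (v ∷ vs) with fill-all vs | fill-path (inj₁ refl) (connected s v)
  ... | k , g , p , filled | inj₁ v≡s =
    k , g , p , λ { (here refl) v≢s → ⊥-elim (v≢s v≡s) ; (there v∈) v≢s → filled v∈ v≢s }
  ... | k , g , p , filled | inj₂ (k' , g' , p' , 1≤g') =
    k + k' , g ⊞ g' ,
    S.⟶-resp (λ w _ → sym (*-distribʳ-+ (u w) k k')) (λ _ _ → refl) (S.⟶-⊞-⟶ p p') ,
    λ { (here refl) _ → ≤-trans 1≤g' (m≤n+m _ _) ; (there v∈) v≢s → ≤-trans (filled v∈ v≢s) (m≤m+n _ _) }

  flood : ∀ c → ∃[ k ] ∃[ g ] (k · u S.⟶ g × (∀ w → w ≢ s → c w ≤ g w))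
  flood c with k , g , p , filled ← fill-all (allFin n) =
    -- No entry of `c` exceeds `tot c`, so `tot c` copies of a configuration with a chip everywhere
    -- off `s` dominate `c`.
    tot c * k , tot c · g ,
    S.⟶-resp (λ w _ → sym (*-assoc (tot c) k (u w))) (λ _ _ → refl) (S.⟶-· (tot c) p) ,
    λ w w≢s → ≤-trans (≤-tot c w) (≤-trans (≤-reflexive (sym (*-identityʳ _))) (*-monoʳ-≤ (tot c) (filled (∈-allFin w) w≢s)))

  sinkCyclic-iterate : ∀ {c k} → c ⊞ k · u S.⟶ c → ∀ j → c ⊞ (j * k) · u S.⟶ c
  sinkCyclic-iterate {c} p zero    = [] , S.done λ w _ → +-identityʳ (c w)
  sinkCyclic-iterate {c} {k} p (suc j) =
    S.⟶-trans (S.⟶-resp (λ w w≢s → sym (sum-⊞ c k (j * k) w w≢s)) (λ _ _ → refl) (S.⟶-⊞ ((j * k) · u) p))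
      (sinkCyclic-iterate p j)

  Absorbing : Conf → Set
  Absorbing c = ∀ c₁ → ∃[ c₂ ] c₁ ⊞ c₂ S.⟶ c

  -- By iteration, `c` with `j * k` copies of `u` returns to `c`. Flooding `k` times with the same
  -- copies leads instead to `c ⊞ k · g`, which dominates `c₁` and by the abelian property still
  -- stabilizes to `c`; `c₂` is the difference.
  sinkCyclic⇒absorbing : ∀ {c} → S.Stable c → SinkCyclic c → Absorbing c
  sinkCyclic⇒absorbing {c} stable (k , 1≤k , p) c₁ with j , g , q , c₁≤g ← flood c₁ =
    (λ w → c w + k * g w ∸ c₁ w) ,
    S.⟶-resp (λ w w≢s → sym (m+[n∸m]≡n (enough w w≢s))) (λ _ _ → refl)
      (S.⟶-stable flooded (sinkCyclic-iterate p j) stable)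
    where
    open ≤-Reasoning
    enough : ∀ w → w ≢ s → c₁ w ≤ c w + k * g w
    enough w w≢s = begin
      c₁ w          ≤⟨ c₁≤g w w≢s ⟩
      g w           ≡⟨ *-identityˡ _ ⟨
      1 * g w       ≤⟨ *-monoˡ-≤ (g w) 1≤k ⟩
      k * g w       ≤⟨ m≤n+m _ _ ⟩
      c w + k * g w ∎
    flooded : c ⊞ (j * k) · u S.⟶ c ⊞ k · g
    flooded = S.⟶-resp (λ w _ → cong (c w +_) (trans (sym (*-assoc k j (u w))) (cong (_* u w) (*-comm k j)))) (λ _ _ → refl)
      (S.⟶-⊞-⟶ (S.⟶-refl {c}) (S.⟶-· k q))

  -- Any cycle of the sinkless model, superimposed on the chips that stabilize to c,
  -- shows that c survives the addition of some multiple of u.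

  absorbing⇒sinkCyclic : ∀ {c} → S.Stable c → Absorbing c → SinkCyclic c
  absorbing⇒sinkCyclic {c} stable absorb
    with d , cyc ← cyclic-exists
    with k , 1≤k , p ← cyclic⇒sinkCyclic cyc
    with c₂ , q ← absorb d =
    k , 1≤k , S.⟶-stable (S.⟶-⊞ (k · u) q)
      (S.⟶-trans (S.⟶-resp (λ w _ → xy∙z≈xz∙y (d w) (k * u w) (c₂ w)) (λ _ _ → refl) (S.⟶-⊞ c₂ p)) q) stable

  Halts : Conf → Set
  Halts c = ∃[ d ] ∃[ j ] (c ⟶ d × Stable d × c ⊞ j · u S.⟶ d)

  round : ∀ {c} → deg s ≤ c s → ∃[ σ ] ∃[ d ] (Run c (s ∷ σ) d × S.Stable d × c ⊞ 1 · u S.⟶ d)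
  round {c} legal with σ , d , r , r' , stable ← stabilize (after c s) =
    σ , d , next tt legal st r , stable ,
    (σ , S.run-resp (λ w w≢s → sym (step-sink st w w≢s)) (λ _ _ → refl) r')
    where
    st : Step c s (after c s)
    st = step λ w _ → after-balance legal w

  -- Each round fires `s` once and stabilizes off `s`, until `t` rounds are done or `s` cannot fire.
  -- In the model with sink a round is the addition of one `u`.
  rounds : ∀ t {c} → S.Stable c → Halts c ⊎
    (∃[ σ ] ∃[ d ] (Run c σ d × S.Stable d × c ⊞ t · u S.⟶ d × (1 ≤ t → σ ≢ [])))
  rounds zero {c} stable =
    inj₂ ([] , c , done (λ _ _ → refl) , stable , ([] , S.done λ w _ → +-identityʳ (c w)) , λ ())
  rounds (suc t) {c} stable with deg s ≤? c s
  ... | no ¬legal = inj₁ (c , 0 , ⟶-refl , all-stable , ([] , S.done λ w _ → +-identityʳ (c w)))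
    where
    all-stable : Stable c
    all-stable w _ with w ≟ s
    ... | yes refl = ≰⇒> ¬legal
    ... | no  w≢s  = stable w w≢s
  ... | yes legal with σ , c' , r , stable' , p ← round legal | rounds t stable'
  ...   | inj₁ (d , j , q , std , q') = inj₁ (d , suc j , ⟶-trans (_ , r) q , std ,
    S.⟶-trans (S.⟶-resp (λ w w≢s → sym (sum-⊞ c 1 j w w≢s)) (λ _ _ → refl) (S.⟶-⊞ (j · u) p)) q')
  ...   | inj₂ (τ , d , q , std , q' , _) = inj₂ (_ , d , run-++ r q , std ,
    S.⟶-trans (S.⟶-resp (λ w w≢s → sym (sum-⊞ c 1 t w w≢s)) (λ _ _ → refl) (S.⟶-⊞ (t · u) p)) q' , λ _ ())

  halts-not-⟶-cyclic : ∀ {c d} → Halts c → c ⟶ d → ¬ Cyclic d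
  halts-not-⟶-cyclic (e , _ , p , stable , _) q cyc =
    stable-not-cyclic stable (cyclic-⟶ cyc (⟶-stable q p stable))

  -- If all `k` rounds of the burning test succeed, the result agrees with `c` off `s` by uniqueness
  -- of stabilization, and at `s` because no chip is lost.
  cyclic-or-halts : ∀ {c} → S.Stable c → SinkCyclic c → Cyclic c ⊎ Halts c
  cyclic-or-halts {c} stable (k , 1≤k , p) with rounds k stable
  ... | inj₁ halts = inj₂ halts
  ... | inj₂ ([] , _ , _ , _ , _ , nonempty) = ⊥-elim (nonempty 1≤k refl)
  ... | inj₂ (v ∷ σ , d , r , std , q , _) = inj₁ (v , σ ,
    run-resp (λ _ _ → refl) (≈-extend (S.stabilization-unique q std p stable) (sym (⟶-tot (_ , r)))) r)

  halts-tot : ∀ {c} → Halts c → tot c < tot deg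
  halts-tot (_ , _ , p , stable , _) = subst (_< tot deg) (sym (⟶-tot p)) (stable-tot stable)

  -- A cyclic configuration never halts, so every addition of copies of `u` lifts to a legal
  -- sinkless run.
  cyclic-rounds : ∀ {c d t} → S.Stable c → Cyclic c → c ⊞ t · u S.⟶ d → S.Stable d →
    ∃[ e ] (c ⟶ e × e S.≈ d)
  cyclic-rounds {t = t} stable cyc p std with rounds t stable
  ... | inj₁ halts = ⊥-elim (halts-not-⟶-cyclic halts ⟶-refl cyc)
  ... | inj₂ (σ , e , r , ste , q , _) = e , (σ , r) , S.stabilization-unique q ste p std

  cyclic-sink : ∀ {c} → S.Stable c → Cyclic c → deg s ≤ c s
  cyclic-sink stable cyc with v , legal ← cyclic-unstable cyc with v ≟ s
  ... | yes refl = legal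
  ... | no  v≢s  = ⊥-elim (<⇒≱ (stable v v≢s) legal)

-- Translation between functions and the vectors of the definitions.

module Bridge {n : ℕ} (E : Digraph n) (connected : StronglyConnected E) (s : Fin n) where

  open Firing E
  open Recurrence E connected
  open WithSink E connected s
  open Sink E s

  lookup-ext : ∀ {c d : Config E} → lookup c ≗ lookup d → c ≡ d
  lookup-ext {c} {d} eq = trans (sym (tabulate∘lookup c)) (trans (tabulate-cong eq) (tabulate∘lookup d))

  total≡tot : ∀ (c : Config E) → total E c ≡ tot (lookup c)
  total≡tot c = cong sum (sym (tabulate∘lookup c))

  refund : ∀ {a b} c → b ≤ a → a ∸ b + c + b ≡ a + c
  refund {a} {b} c b≤a = trans (xy∙z≈xz∙y (a ∸ b) c b) (cong (_+ c) (m∸n+n≡m b≤a))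

  fire-step : ∀ {c v} → deg v ≤ lookup c v → Step (lookup c) v (lookup (fire E c v))
  fire-step {c} {v} legal = step at
    where
    at : ∀ w → ⊤ → lookup (fire E c v) w + cost v w ≡ lookup c w + E v w
    at w _ with w ≟ v | (lookup (fire E c v) w ≡ _ ∋ lookup∘tabulate _ w)
    ... | yes refl | eq = trans (cong (_+ deg v) eq) (refund (E v v) legal)
    ... | no  _    | eq = trans (+-identityʳ _) eq

  sfire-step : ∀ {c v} → deg v ≤ lookup c v → S.Step (lookup c) v (lookup (sfire c v))
  sfire-step {c} {v} legal = S.step at
    where
    at : ∀ w → w ≢ s → lookup (sfire c v) w + cost v w ≡ lookup c w + E v w
    at w w≢s with w ≟ s | w ≟ v | (lookup (sfire c v) w ≡ _ ∋ lookup∘tabulate _ w)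
    ... | yes w≡s | _        | _  = ⊥-elim (w≢s w≡s)
    ... | no _    | yes refl | eq = trans (cong (_+ deg v) eq) (refund (E v v) legal)
    ... | no _    | no _     | eq = trans (+-identityʳ _) eq

  sfire-sconf : ∀ c v → IsSConf (sfire c v)
  sfire-sconf c v with s ≟ s | s ≟ v | (lookup (sfire c v) s ≡ _ ∋ lookup∘tabulate _ s)
  ... | yes _  | _ | eq = eq
  ... | no s≢s | _ | _  = ⊥-elim (s≢s refl)

  ⇝⇒⟶ : ∀ {c d} → _⇝_ E c d → lookup c ⟶ lookup d
  ⇝⇒⟶ ε = ⟶-refl
  ⇝⇒⟶ ((v , legal , refl) ◅ p) with σ , r ← ⇝⇒⟶ p = v ∷ σ , next tt legal (fire-step legal) r

  run⇒⇝ : ∀ {c d} σ → Run (lookup c) σ (lookup d) → _⇝_ E c d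
  run⇒⇝ {c} {d} [] (done eq) with refl ← lookup-ext {c} {d} (λ w → eq w tt) = ε
  run⇒⇝ {c} (v ∷ σ) (next _ legal st r) = (v , legal , refl) ◅
    run⇒⇝ σ (run-resp (step-unique st (fire-step legal)) (λ _ _ → refl) r)

  ⟶⇒⇝ : ∀ {c d} → lookup c ⟶ lookup d → _⇝_ E c d
  ⟶⇒⇝ (σ , r) = run⇒⇝ σ r

  recurrent⇒cyclic : ∀ {c} → Recurrent E c → Cyclic (lookup c)
  recurrent⇒cyclic ((v , legal) , back) with σ , r ← ⇝⇒⟶ (back _ ((v , legal , refl) ◅ ε)) =
    v , σ , next tt legal (fire-step legal) r

  cyclic⇒recurrent : ∀ {c} → Cyclic (lookup c) → Recurrent E c
  cyclic⇒recurrent cyc = cyclic-unstable cyc , λ d p → ⟶⇒⇝ (⟶-sym cyc (⇝⇒⟶ p))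

  ⇝s⇒⟶ : ∀ {c d} → c ⇝s d → lookup c S.⟶ lookup d
  ⇝s⇒⟶ ε = S.⟶-refl
  ⇝s⇒⟶ ((v , v≢s , legal , refl) ◅ p) with σ , r ← ⇝s⇒⟶ p = v ∷ σ , S.next v≢s legal (sfire-step legal) r

  ⇝s-sconf : ∀ {c d} → IsSConf c → c ⇝s d → IsSConf d
  ⇝s-sconf sc ε = sc
  ⇝s-sconf {c} sc ((v , _ , _ , refl) ◅ p) = ⇝s-sconf (sfire-sconf c v) p

  sconf-ext : ∀ {c d} → IsSConf c → IsSConf d → lookup c S.≈ lookup d → c ≡ d
  sconf-ext {c} {d} sc sd eq = lookup-ext ext
    where
    ext : lookup c ≗ lookup d
    ext w with w ≟ s
    ... | yes refl = trans sc (sym sd)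
    ... | no  w≢s  = eq w w≢s

  run⇒⇝s : ∀ {c d} σ → IsSConf c → IsSConf d → S.Run (lookup c) σ (lookup d) → c ⇝s d
  run⇒⇝s {c} {d} [] sc sd (S.done eq) with refl ← sconf-ext {c} {d} sc sd eq = ε
  run⇒⇝s {c} (v ∷ σ) sc sd (S.next v≢s legal st r) = (v , v≢s , legal , refl) ◅
    run⇒⇝s σ (sfire-sconf c v) sd (S.run-resp (S.step-unique st (sfire-step legal)) (λ _ _ → refl) r)

  ⟶⇒⇝s : ∀ {c d} → IsSConf c → IsSConf d → lookup c S.⟶ lookup d → c ⇝s d
  ⟶⇒⇝s sc sd (σ , r) = run⇒⇝s σ sc sd r

  trim : Conf → Config E
  trim c = updateAt (tabulate c) s (λ _ → 0)

  trim-sconf : ∀ c → IsSConf (trim c)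
  trim-sconf c = lookup∘updateAt s (tabulate c)

  lookup-trim : ∀ c → lookup (trim c) S.≈ c
  lookup-trim c w w≢s = trans (lookup∘updateAt′ w s w≢s (tabulate c)) (lookup∘tabulate c w)

  tot-≈ : ∀ {c d} → IsSConf d → c S.≈ lookup d → tot c ≡ c s + total E d
  tot-≈ {c} {d} sd eq = begin
    tot c                   ≡⟨ +-identityʳ _ ⟨
    tot c + 0               ≡⟨ cong (tot c +_) sd ⟨
    tot c + lookup d s      ≡⟨ tot-change s eq ⟩
    tot (lookup d) + c s    ≡⟨ +-comm _ (c s) ⟩
    c s + tot (lookup d)    ≡⟨ cong (c s +_) (total≡tot d) ⟨
    c s + total E d         ∎
    where open ≡-Reasoning

  ⊕-sconf : ∀ {c d} → IsSConf c → IsSConf d → IsSConf (c ⊕ d)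
  ⊕-sconf {c} {d} sc sd = trans (lookup-zipWith _+_ s c d) (cong₂ _+_ sc sd)

  lookup-scale : ∀ k c w → lookup (scale k c) w ≡ k * lookup c w
  lookup-scale k c w = trans (lookup-zipWith _*_ w (replicate n k) c) (cong (_* lookup c w) (lookup-replicate w k))

  lookup-us : lookup us S.≈ u
  lookup-us w w≢s with w ≟ s | (lookup us w ≡ _ ∋ lookup∘tabulate _ w)
  ... | yes w≡s | _  = ⊥-elim (w≢s w≡s)
  ... | no  _   | eq = eq

  us-sconf : IsSConf us
  us-sconf with s ≟ s | (lookup us s ≡ _ ∋ lookup∘tabulate _ s)
  ... | yes _  | eq = eq
  ... | no s≢s | _  = ⊥-elim (s≢s refl)

  ⊕-us-sconf : ∀ {c} k → IsSConf c → IsSConf (c ⊕ scale k us)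
  ⊕-us-sconf {c} k sc = ⊕-sconf {c} {scale k us} sc
    (trans (lookup-scale k us s) (trans (cong (k *_) us-sconf) (*-zeroʳ k)))

  lookup-⊕-us : ∀ c k → lookup (c ⊕ scale k us) S.≈ lookup c ⊞ k · u
  lookup-⊕-us c k w w≢s = trans (lookup-zipWith _+_ w c (scale k us))
    (cong (lookup c w +_) (trans (lookup-scale k us w) (cong (k *_) (lookup-us w w≢s))))

  ∼s⇒⟶ : ∀ {c d} → c ∼s d → ∃[ k ] (lookup c ⊞ k · u S.⟶ lookup d)
  ∼s⇒⟶ {c} (k , p , _) = k , S.⟶-resp (lookup-⊕-us c k) (λ _ _ → refl) (⇝s⇒⟶ p)

  ⟶⇒∼s : ∀ {c d} k → IsSConf c → IsSConf d → S.Stable (lookup d) → lookup c ⊞ k · u S.⟶ lookup d → c ∼s d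
  ⟶⇒∼s {c} k sc sd std p = k ,
    ⟶⇒⇝s (⊕-us-sconf {c} k sc) sd (S.⟶-resp (λ w w≢s → sym (lookup-⊕-us c k w w≢s)) (λ _ _ → refl) p) , std

  srecurrent-stable : ∀ {c} → SRecurrent c → S.Stable (lookup c)
  -- Any s-configuration would serve as the probe; only the stability of the outcome is kept.
  srecurrent-stable (_ , absorb) = proj₂ (proj₂ (proj₂ (absorb us us-sconf)))

  srecurrent⇒sinkCyclic : ∀ {c} → SRecurrent c → SinkCyclic (lookup c)
  srecurrent⇒sinkCyclic {c} rec@(_ , absorb) = absorbing⇒sinkCyclic (srecurrent-stable rec) λ c₁ →
    let c₂ , _ , p , _ = absorb (trim c₁) (trim-sconf c₁)
    in lookup c₂ , S.⟶-resp
      (λ w w≢s → trans (lookup-zipWith _+_ w (trim c₁) c₂) (cong (_+ lookup c₂ w) (lookup-trim c₁ w w≢s)))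
      (λ _ _ → refl) (⇝s⇒⟶ p)

  sinkCyclic⇒srecurrent : ∀ {c} → IsSConf c → S.Stable (lookup c) → SinkCyclic (lookup c) → SRecurrent c
  sinkCyclic⇒srecurrent {c} sc stable cyc = sc , λ c₁ sc₁ →
    let c₂ , p = sinkCyclic⇒absorbing stable cyc (lookup c₁)
    in trim c₂ , trim-sconf c₂ , ⟶⇒⇝s (⊕-sconf {c₁} {trim c₂} sc₁ (trim-sconf c₂)) sc
      (S.⟶-resp (λ w w≢s → sym (trans (lookup-zipWith _+_ w c₁ (trim c₂)) (cong (lookup c₁ w +_) (lookup-trim c₂ w w≢s))))
        (λ _ _ → refl) p) , stable

  -- Chips on the sink and the number χ.

  chips : ℕ → Conf
  chips k w with w ≟ s
  ... | yes _ = k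
  ... | no  _ = 0

  chips-s : ∀ k → chips k s ≡ k
  chips-s k with s ≟ s
  ... | yes _  = refl
  ... | no s≢s = ⊥-elim (s≢s refl)

  chips-≢ : ∀ k {w} → w ≢ s → chips k w ≡ 0
  chips-≢ k {w} w≢s with w ≟ s
  ... | yes w≡s = ⊥-elim (w≢s w≡s)
  ... | no  _   = refl

  chips-+ : ∀ j k w → chips (j + k) w ≡ chips j w + chips k w
  chips-+ j k w with w ≟ s
  ... | yes _ = refl
  ... | no  _ = refl

  tot-chips : ∀ k → tot (chips k) ≡ k
  tot-chips k = begin
    tot (chips k)                   ≡⟨ +-identityʳ _ ⟨
    tot (chips k) + 0               ≡⟨ tot-change s (λ w → chips-≢ k) ⟩
    tot {n} (λ _ → 0) + chips k s   ≡⟨ cong₂ _+_ (tot-0 n) (chips-s k) ⟩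
    k                               ∎
    where open ≡-Reasoning

  lookup-addSink : ∀ k c w → lookup (addSink k c) w ≡ lookup c w + chips k w
  lookup-addSink k c w with w ≟ s
  ... | yes refl = lookup∘updateAt s c
  ... | no  w≢s  = trans (lookup∘updateAt′ w s w≢s c) (sym (+-identityʳ _))

  tot-addSink : ∀ k c → tot (lookup (addSink k c)) ≡ k + total E c
  tot-addSink k c = begin
    tot (lookup (addSink k c))          ≡⟨ tot-cong (lookup-addSink k c) ⟩
    tot (lookup c ⊞ chips k)            ≡⟨ tot-+ (lookup c) (chips k) ⟩
    tot (lookup c) + tot (chips k)      ≡⟨ cong₂ _+_ (sym (total≡tot c)) (tot-chips k) ⟩
    total E c + k                       ≡⟨ +-comm _ k ⟩
    k + total E c                       ∎
    where open ≡-Reasoning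

  total-addSink : ∀ k c → total E (addSink k c) ≡ k + total E c
  total-addSink k c = trans (total≡tot (addSink k c)) (tot-addSink k c)

  addSink-≈ : ∀ k c → lookup c S.≈ lookup (addSink k c)
  addSink-≈ k c w w≢s = sym (lookup∘updateAt′ w s w≢s c)

  addSink-+ : ∀ j k c → lookup (addSink k c) ⊞ chips j ≈ lookup (addSink (j + k) c)
  addSink-+ j k c w _ = begin
    lookup (addSink k c) w + chips j w      ≡⟨ cong (_+ chips j w) (lookup-addSink k c w) ⟩
    lookup c w + chips k w + chips j w      ≡⟨ xy∙z≈x∙zy (lookup c w) (chips k w) (chips j w) ⟩
    lookup c w + (chips j w + chips k w)    ≡⟨ cong (lookup c w +_) (chips-+ j k w) ⟨
    lookup c w + chips (j + k) w            ≡⟨ lookup-addSink (j + k) c w ⟨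
    lookup (addSink (j + k) c) w            ∎
    where open ≡-Reasoning

  addSink-stable : ∀ {c} k → S.Stable (lookup c) → S.Stable (lookup (addSink k c))
  addSink-stable {c} k stable w w≢s = subst (_< deg w) (addSink-≈ k c w w≢s) (stable w w≢s)

  addSink-s : ∀ k {c} → IsSConf c → lookup (addSink k c) s ≡ k
  addSink-s k {c} sc = trans (lookup∘updateAt s c) (cong (_+ k) sc)

  addSink-trim : ∀ c → lookup (addSink (c s) (trim c)) ≗ c
  addSink-trim c w with w ≟ s
  ... | yes refl = addSink-s (c s) {trim c} (trim-sconf c)
  ... | no  w≢s  = trans (sym (addSink-≈ (c s) (trim c) w w≢s)) (lookup-trim c w w≢s)

  addSink-cyclic-or-halts : ∀ {c} k → SRecurrent c →
    Cyclic (lookup (addSink k c)) ⊎ Halts (lookup (addSink k c))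
  addSink-cyclic-or-halts {c} k rec = cyclic-or-halts (addSink-stable {c} k (srecurrent-stable rec))
    (sinkCyclic-resp (addSink-≈ k c) (srecurrent⇒sinkCyclic rec))

  addSink-mono : ∀ {c j k} → j ≤ k → Cyclic (lookup (addSink j c)) → Cyclic (lookup (addSink k c))
  addSink-mono {c} {j} j≤k cyc with o , refl ← m≤n⇒∃[o]m+o≡n j≤k =
    subst (λ k → Cyclic (lookup (addSink k c))) (+-comm o j)
      (cyclic-resp (addSink-+ o j c) (cyclic-⊞ (chips o) cyc))

  -- Cyclicity is monotone in the number of chips on `s` (`addSink-mono`), so minimality is tested
  -- only one chip below; for `k` zero the test is vacuous.
  isChi-intro : ∀ {c k} → Cyclic (lookup (addSink k c)) →
    (∀ {j} → k ≡ suc j → ¬ Cyclic (lookup (addSink j c))) → IsChi c k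
  isChi-intro {c} {k} cyc minimal = cyclic⇒recurrent cyc , least minimal
    where
    least : ∀ {k} → (∀ {j} → k ≡ suc j → ¬ Cyclic (lookup (addSink j c))) →
            ∀ j → j < k → ¬ Recurrent E (addSink j c)
    least minimal j (s≤s j≤k) r = minimal refl (addSink-mono {c} j≤k (recurrent⇒cyclic r))

  addSink-halts-bound : ∀ {c k} → Halts (lookup (addSink k c)) → k < tot deg
  addSink-halts-bound {c} {k} halts = ≤-<-trans (m≤m+n k (total E c))
    (subst (_< tot deg) (tot-addSink k c) (halts-tot halts))

  chi-or-lower : ∀ {c} k → SRecurrent c → Cyclic (lookup (addSink k c)) →
    IsChi c k ⊎ (∃[ j ] (k ≡ suc j × Cyclic (lookup (addSink j c))))
  chi-or-lower zero    rec cyc = inj₁ (isChi-intro cyc λ ())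
  chi-or-lower (suc k) rec cyc with addSink-cyclic-or-halts k rec
  ... | inj₁ cyc'  = inj₂ (k , refl , cyc')
  ... | inj₂ halts = inj₁ (isChi-intro cyc λ { refl → halts-not-⟶-cyclic halts ⟶-refl })

  chi-below : ∀ {c} → SRecurrent c → ∀ k → Cyclic (lookup (addSink k c)) → ∃[ j ] IsChi c j
  chi-below rec k cyc with chi-or-lower k rec cyc
  ... | inj₁ chi              = k , chi
  ... | inj₂ (j , refl , cyc') = chi-below rec j cyc'

  -- With `tot deg` chips on `s` there are too many to halt. From there chips are removed one at a
  -- time, `cyclic-or-halts` deciding when to stop.
  chi-exists : ∀ {c} → SRecurrent c → ∃[ k ] IsChi c k
  chi-exists {c} rec with addSink-cyclic-or-halts (tot deg) rec
  ... | inj₁ cyc   = chi-below rec (tot deg) cyc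
  ... | inj₂ halts = ⊥-elim (<-irrefl refl (addSink-halts-bound {c} halts))

  deg≤chi : ∀ {c k} → SRecurrent c → IsChi c k → deg s ≤ k
  deg≤chi {c} {k} rec (r , _) = subst (deg s ≤_) (addSink-s k {c} (proj₁ rec))
    (cyclic-sink (addSink-stable {c} k (srecurrent-stable rec)) (recurrent⇒cyclic r))

  addSink-∼s : ∀ {c d k} → SRecurrent c → Cyclic (lookup (addSink k c)) → S.Stable (lookup d) → c ∼s d →
    ∃[ e ] (lookup (addSink k c) ⟶ e × e S.≈ lookup d)
  addSink-∼s {c} {d} {k} rec cyc std c∼d with t , p ← ∼s⇒⟶ c∼d =
    cyclic-rounds {t = t} (addSink-stable {c} k (srecurrent-stable rec)) cyc
      (S.⟶-resp (λ w w≢s → cong (_+ t * u w) (addSink-≈ k c w w≢s)) (λ _ _ → refl) p) std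

  -- The maximal d-level of a class is its s-level.

  stable-≈ : ∀ {c d} → c S.≈ d → S.Stable d → S.Stable c
  stable-≈ eq std w w≢s = subst (_< deg w) (sym (eq w w≢s)) (std w w≢s)

  -- The lift `e` of `d` is still recurrent and stable off `s`, so only `s` can fire and holds at
  -- least `deg s` chips; the rest is conservation.
  dlvl-bounded : ∀ {c d k} → SRecurrent c → IsChi c k → c ∼s d → dlvl d ≤ k + total E c
  dlvl-bounded {c} {d} {k} rec (r , _) c∼d@(_ , p , std)
    with e , q , eq ← addSink-∼s rec (recurrent⇒cyclic r) std c∼d = begin
    deg s + total E d           ≤⟨ +-monoˡ-≤ _ (cyclic-sink (stable-≈ eq std) (cyclic-⟶ (recurrent⇒cyclic r) q)) ⟩
    e s + total E d             ≡⟨ tot-≈ {d = d} (⇝s-sconf (⊕-us-sconf {c} _ (proj₁ rec)) p) eq ⟨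
    tot e                       ≡⟨ ⟶-tot q ⟨
    tot (lookup (addSink k c))  ≡⟨ tot-addSink k c ⟩
    k + total E c               ∎
    where open ≤-Reasoning

  -- One chip short of recurrence the process halts with deg s - 1 chips on the sink,
  -- and it halts at the member of the class with the largest d-level.

  dlvl-attained : ∀ {c k} → SRecurrent c → IsChi c k → ∃[ d ] (c ∼s d × dlvl d ≡ k + total E c)
  -- Here `deg≤chi` forces `deg s` to be zero, and `c` itself attains the value.
  dlvl-attained {c} {zero} rec chi =
    c , ⟶⇒∼s {c} 0 (proj₁ rec) (proj₁ rec) (srecurrent-stable rec) ([] , S.done λ w _ → +-identityʳ _) ,
    cong (_+ total E c) (n≤0⇒n≡0 (deg≤chi rec chi))
  dlvl-attained {c} {suc k} rec (r , minimal) with addSink-cyclic-or-halts k rec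
  ... | inj₁ cyc = ⊥-elim (minimal k ≤-refl (cyclic⇒recurrent cyc))
  ... | inj₂ (e , j , p , stable , q) = trim e ,
    ⟶⇒∼s {c} j (proj₁ rec) (trim-sconf e) (stable-≈ (lookup-trim e) λ w _ → stable w tt)
      (S.⟶-resp (λ w w≢s → cong (_+ j * u w) (sym (addSink-≈ k c w w≢s))) (λ w w≢s → sym (lookup-trim e w w≢s)) q) ,
    (begin
      deg s + total E (trim e)          ≡⟨ cong (_+ total E (trim e)) (≤-antisym deg≤ (stable s tt)) ⟩
      suc (e s + total E (trim e))      ≡⟨ cong suc (tot-≈ {d = trim e} (trim-sconf e) (λ w w≢s → sym (lookup-trim e w w≢s))) ⟨
      suc (tot e)                       ≡⟨ cong suc (⟶-tot p) ⟨
      suc (tot (lookup (addSink k c)))  ≡⟨ cong suc (tot-addSink k c) ⟩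
      suc (k + total E c)               ∎)
    where
    open ≡-Reasoning
    -- With the missing chip restored, the same firings end at a recurrent configuration, so `s` can
    -- fire there: `e s` is at least `deg s` less one, and stability of `e` gives the converse
    -- bound.
    more : lookup (addSink (suc k) c) ⟶ e ⊞ chips 1
    more = ⟶-resp (addSink-+ 1 k c) (λ _ _ → refl) (⟶-⊞ (chips 1) p)
    deg≤ : deg s ≤ suc (e s)
    deg≤ = subst (deg s ≤_) (trans (cong (e s +_) (chips-s 1)) (+-comm (e s) 1))
      (cyclic-sink (λ w w≢s → subst (_< deg w) (sym (trans (cong (e w +_) (chips-≢ 1 w≢s)) (+-identityʳ _))) (stable w tt))
        (cyclic-⟶ (recurrent⇒cyclic r) more))

  slevel⇒classDLevel : ∀ {c m} → SRecurrent c → SLevel c m → ClassDLevel c m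
  slevel⇒classDLevel rec (k , chi , refl) = dlvl-attained rec chi , λ d → dlvl-bounded rec chi

  classDLevel⇒slevel : ∀ {c m} → SRecurrent c → ClassDLevel c m → SLevel c m
  classDLevel⇒slevel rec ((d , c∼d , refl) , bound) with k , chi ← chi-exists rec =
    k , chi , ≤-antisym (dlvl-bounded rec chi c∼d)
      (let e , c∼e , eq = dlvl-attained rec chi in subst (_≤ dlvl d) eq (bound e c∼e))

  -- Classes of the two models and the map adding a chip to the sink.

  ∼-euclidean : ∀ {c d e} → Recurrent E c → _∼_ E c d → _∼_ E c e → _∼_ E d e
  ∼-euclidean (_ , back) p q = back _ p ◅◅ q

  ⟶⇒∼s-via : ∀ {c d c' d'} → SRecurrent c → SRecurrent d →
    c' S.≈ lookup c → d' S.≈ lookup d → c' ⟶ d' → c ∼s d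
  ⟶⇒∼s-via {c} {d} (sc , _) recd c≈ d≈ (σ , r) with j , p , _ ← project r =
    ⟶⇒∼s {c} j sc (proj₁ recd) (srecurrent-stable recd) (S.⟶-resp (λ w w≢s → cong (_+ j * u w) (c≈ w w≢s)) d≈ p)

  -- Both relations lift to runs from `c` with χ chips on `s`, where legal reachability is
  -- symmetric; the run between the two lifts is then projected back.
  ∼s-euclidean : ∀ {c d e} → SRecurrent c → SRecurrent d → SRecurrent e → c ∼s d → c ∼s e → d ∼s e
  ∼s-euclidean rc rd re c∼d c∼e
    with k , r , _ ← chi-exists rc
    with d' , p , d≈ ← addSink-∼s rc (recurrent⇒cyclic r) (srecurrent-stable rd) c∼d
       | e' , q , e≈ ← addSink-∼s rc (recurrent⇒cyclic r) (srecurrent-stable re) c∼e =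
    ⟶⇒∼s-via rd re d≈ e≈ (⟶-trans (⟶-sym (recurrent⇒cyclic r) p) q)

  -- Cancelling one chip on `s` by `return-⊞` would give a run from `c` with one chip fewer than χ,
  -- which halts, to the recurrent `d`.
  chi-not-raised : ∀ {c d k} → SRecurrent c → IsChi c k → Cyclic (lookup d) →
    ¬ (lookup (addSink 1 d) ⟶ lookup (addSink k c))
  -- There is no chip to cancel here, but `deg s` is zero: `s` never loses chips, yet would start
  -- with at least one and end with none.
  chi-not-raised {c} {d} {zero} rec chi cyc (σ , run) =
    case trans (sym (run-balanced run .Balanced.at s tt)) (cong₂ _+_ (addSink-s 0 {c} (proj₁ rec)) (loss-deg0 σ deg≡0)) of
      λ eq → 1+n≢0 (trans (sym (trans (lookup∘updateAt s d) (+-comm _ 1))) (m+n≡0⇒m≡0 _ eq))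
    where
    deg≡0 : deg s ≡ 0
    deg≡0 = n≤0⇒n≡0 (deg≤chi rec chi)
  chi-not-raised {c} {d} {suc k} rec (_ , minimal) cyc p with addSink-cyclic-or-halts k rec
  ... | inj₁ cyc'  = minimal k ≤-refl (cyclic⇒recurrent cyc')
  ... | inj₂ halts = halts-not-⟶-cyclic halts
    (return-⊞ (chips 1) cyc (⟶-resp (λ w _ → lookup-addSink 1 d w) (λ w p → sym (addSink-+ 1 k c w p)) p)) cyc

  raise-recurrent : ∀ {c} → Recurrent E c → Recurrent E (addSink 1 c)
  raise-recurrent {c} r = cyclic⇒recurrent
    (cyclic-resp (λ w _ → sym (lookup-addSink 1 c w)) (cyclic-⊞ (chips 1) (recurrent⇒cyclic r)))

  raise-∼ : ∀ {c d} → _∼_ E c d → _∼_ E (addSink 1 c) (addSink 1 d)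
  raise-∼ {c} {d} p = ⟶⇒⇝ (⟶-resp (λ w _ → sym (lookup-addSink 1 c w)) (λ w _ → sym (lookup-addSink 1 d w))
    (⟶-⊞ (chips 1) (⇝⇒⟶ p)))

  -- `return-⊞` yields the run in the reverse direction, and recurrence of `d` turns it around.
  raise-injective : ∀ {c d} → Recurrent E c → Recurrent E d → _∼_ E (addSink 1 c) (addSink 1 d) → _∼_ E c d
  raise-injective {c} {d} r (_ , back) p = back c (⟶⇒⇝ (return-⊞ (chips 1) (recurrent⇒cyclic r)
    (⟶-resp (λ w _ → lookup-addSink 1 c w) (λ w _ → lookup-addSink 1 d w) (⇝⇒⟶ p))))

  ChiOrRaised : Config E → Set
  ChiOrRaised a =
    (∃[ c ] ∃[ k ] (SRecurrent c × IsChi c k × total E a ≡ k + total E c × _∼_ E (addSink k c) a)) ⊎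
    (∃[ d ] (Recurrent E d × suc (total E d) ≡ total E a × _∼_ E (addSink 1 d) a))

  -- The stabilization `e` is an s-recurrent `c` carrying `e s` chips on the sink. Either `e s` is χ
  -- of `c`, or one of these chips can be taken away without losing recurrence.
  stabilized-chiOrRaised : ∀ {a σ e} → Recurrent E a → Run (lookup a) σ e → S.Stable e → ChiOrRaised a
  stabilized-chiOrRaised {a} {σ} {e} r run stable = classify (chi-or-lower {c} k rec cyclic)
    where
    c : Config E
    c = trim e

    k : ℕ
    k = e s

    from-e : e ⟶ lookup a
    from-e = ⟶-sym (recurrent⇒cyclic r) (σ , run)

    cyclic : Cyclic (lookup (addSink k c))
    cyclic = cyclic-resp (λ w _ → sym (addSink-trim e w)) (cyclic-⟶ (recurrent⇒cyclic r) (σ , run))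

    rec : SRecurrent c
    rec = sinkCyclic⇒srecurrent (trim-sconf e) (stable-≈ (lookup-trim e) stable)
      (sinkCyclic-resp (λ w w≢s → sym (addSink-≈ k c w w≢s)) (cyclic⇒sinkCyclic cyclic))

    level : total E a ≡ k + total E c
    level = begin
      total E a                   ≡⟨ total≡tot a ⟩
      tot (lookup a)              ≡⟨ ⟶-tot (σ , run) ⟩
      tot e                       ≡⟨ tot-cong (addSink-trim e) ⟨
      tot (lookup (addSink k c))  ≡⟨ tot-addSink k c ⟩
      k + total E c               ∎
      where open ≡-Reasoning

    raised : ∀ {j} → k ≡ suc j → e ≈ lookup (addSink 1 (addSink j c))
    raised {j} k≡ w p = begin
      e w                                    ≡⟨ addSink-trim e w ⟨
      lookup (addSink k c) w                 ≡⟨ cong (λ i → lookup (addSink i c) w) k≡ ⟩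
      lookup (addSink (suc j) c) w           ≡⟨ addSink-+ 1 j c w p ⟨
      lookup (addSink j c) w + chips 1 w     ≡⟨ lookup-addSink 1 (addSink j c) w ⟨
      lookup (addSink 1 (addSink j c)) w     ∎
      where open ≡-Reasoning

    classify : IsChi c k ⊎ (∃[ j ] (k ≡ suc j × Cyclic (lookup (addSink j c)))) → ChiOrRaised a
    classify (inj₁ chi) = inj₁ (c , k , rec , chi , level ,
      ⟶⇒⇝ (⟶-resp (λ w _ → sym (addSink-trim e w)) (λ _ _ → refl) from-e))
    classify (inj₂ (j , k≡ , cyc)) = inj₂ (addSink j c , cyclic⇒recurrent cyc ,
      trans (cong suc (total-addSink j c)) (trans (cong (_+ total E c) (sym k≡)) (sym level)) ,
      ⟶⇒⇝ (⟶-resp (raised k≡) (λ _ _ → refl) from-e))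

  chiOrRaised : ∀ {a} → Recurrent E a → ChiOrRaised a
  chiOrRaised {a} r = let _ , _ , run , _ , stable = stabilize (lookup a) in stabilized-chiOrRaised r run stable

  -- The lift of `d` agrees with `d` off `s`, and equal levels force its number of chips on `s` to
  -- be `k`.
  chi-∼s⇒∼ : ∀ {c d j k} → SRecurrent c → SRecurrent d → IsChi c j →
    j + total E c ≡ k + total E d → c ∼s d → _∼_ E (addSink j c) (addSink k d)
  chi-∼s⇒∼ {c} {d} {j} {k} rc rd (r , _) level c∼d
    with e , p , eq ← addSink-∼s {c} {d} {j} rc (recurrent⇒cyclic r) (srecurrent-stable rd) c∼d =
    ⟶⇒⇝ (⟶-resp (λ _ _ → refl) (≈-extend (λ w w≢s → trans (eq w w≢s) (addSink-≈ k d w w≢s)) same) p)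
    where
    same : tot e ≡ tot (lookup (addSink k d))
    same = trans (sym (⟶-tot p)) (trans (tot-addSink j c) (trans level (sym (tot-addSink k d))))

  chi-∼⇒∼s : ∀ {c d j k} → SRecurrent c → SRecurrent d → _∼_ E (addSink j c) (addSink k d) → c ∼s d
  chi-∼⇒∼s {c} {d} {j} {k} rc rd p =
    ⟶⇒∼s-via rc rd (λ w w≢s → sym (addSink-≈ j c w w≢s)) (λ w w≢s → sym (addSink-≈ k d w w≢s)) (⇝⇒⟶ p)

  -- The coefficient form of P = (1 - y) R: recurrent classes of level `m` are those with χ chips on
  -- the sink together with the raised ones. The condition `suc (total E c) ≡ m` also covers `m`
  -- zero, where nothing is raised.
  numRec-+ : ∀ {m b r} → CoeffP E s m b →
    NumClasses (λ c → Recurrent E c × suc (total E c) ≡ m) (_∼_ E) r → NumRec E m (b + r)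
  numRec-+ {m} {b} {r} (f , f-ok , f-inj , f-surj) (g , g-ok , g-inj , g-surj) =
    rep ∘ splitAt b , rep-ok ∘ splitAt b ,
    (λ i j p → trans (sym (join-splitAt b r i)) (trans (cong (join b r) (rep-inj (splitAt b i) (splitAt b j) p)) (join-splitAt b r j))) ,
    λ a a-ok → let x , p = cover (proj₂ a-ok) (chiOrRaised (proj₁ a-ok)) in
      join b r x , subst (λ y → _∼_ E (rep y) a) (sym (splitAt-join b r x)) p
    where
    chi : Fin b → ℕ
    chi i = proj₁ (proj₂ (f-ok i))

    rep : Fin b ⊎ Fin r → Config E
    rep (inj₁ i) = addSink (chi i) (f i)
    rep (inj₂ j) = addSink 1 (g j)

    rep-ok : ∀ x → Recurrent E (rep x) × total E (rep x) ≡ m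
    rep-ok (inj₁ i) = let _ , k , (rec , _) , level = f-ok i in rec , trans (total-addSink k (f i)) (sym level)
    rep-ok (inj₂ j) = raise-recurrent (proj₁ (g-ok j)) , trans (total-addSink 1 (g j)) (proj₂ (g-ok j))

    disjoint : ∀ i j → ¬ _∼_ E (rep (inj₂ j)) (rep (inj₁ i))
    disjoint i j p = let rec , k , isChi , _ = f-ok i in
      chi-not-raised {f i} {g j} {k} rec isChi (recurrent⇒cyclic (proj₁ (g-ok j))) (⇝⇒⟶ p)

    rep-inj : ∀ x y → _∼_ E (rep x) (rep y) → x ≡ y
    rep-inj (inj₁ i) (inj₁ j) p = cong inj₁ (f-inj i j (chi-∼⇒∼s {f i} {f j} {chi i} {chi j} (proj₁ (f-ok i)) (proj₁ (f-ok j)) p))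
    rep-inj (inj₁ i) (inj₂ j) p = ⊥-elim (disjoint i j (proj₂ (proj₁ (rep-ok (inj₁ i))) _ p))
    rep-inj (inj₂ j) (inj₁ i) p = ⊥-elim (disjoint i j p)
    rep-inj (inj₂ i) (inj₂ j) p = cong inj₂ (g-inj i j (raise-injective {g i} {g j} (proj₁ (g-ok i)) (proj₁ (g-ok j)) p))

    cover : ∀ {a} → total E a ≡ m → ChiOrRaised a → ∃[ x ] _∼_ E (rep x) a
    cover {a} refl (inj₁ (c , k , rc , isChi , level , p)) =
      let i , f∼c = f-surj c (rc , k , isChi , level)
          rf , _ , isChi' , level' = f-ok i
      in inj₁ i , chi-∼s⇒∼ {f i} {c} {chi i} {k} rf rc isChi' (trans (sym level') level) f∼c ◅◅ p
    cover {a} refl (inj₂ (d , rd , level , p)) =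
      let j , g∼d = g-surj d (rd , level)
      in inj₂ j , raise-∼ {g j} {d} g∼d ◅◅ p

-- Comparing counts of classes.

numClasses-map : ∀ {A : Set} {R R' : A → Set} {_≈_ : A → A → Set} {k} →
  (∀ {a} → R a → R' a) → (∀ {a} → R' a → R a) → NumClasses R _≈_ k → NumClasses R' _≈_ k
numClasses-map to from (f , ok , inj , surj) = f , to ∘ ok , inj , λ a → surj a ∘ from

-- Sending `f i` to the index of its class under `g` is injective: two representatives with one
-- index are related from the same `g x`. The Euclidean property is asked on `R` because recurrence
-- is what provides symmetry.
numClasses-≤ : ∀ {A : Set} {R : A → Set} {_≈_ : A → A → Set} {k l} →
  (∀ {a b c} → R a → R b → R c → a ≈ b → a ≈ c → b ≈ c) →
  NumClasses R _≈_ k → NumClasses R _≈_ l → k ≤ l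
numClasses-≤ {_≈_ = _≈_} euclidean (f , f-ok , f-inj , _) (g , g-ok , _ , g-surj) =
  injective⇒≤ {f = index} λ {i} {j} eq → f-inj i j
    (euclidean (g-ok (index i)) (f-ok i) (f-ok j) (proj₂ (g-surj (f i) (f-ok i)))
      (subst (λ x → g x ≈ f j) (sym eq) (proj₂ (g-surj (f j) (f-ok j)))))
  where
  index : Fin _ → Fin _
  index i = proj₁ (g-surj (f i) (f-ok i))

numClasses-unique : ∀ {A : Set} {R : A → Set} {_≈_ : A → A → Set} {k l} →
  (∀ {a b c} → R a → R b → R c → a ≈ b → a ≈ c → b ≈ c) →
  NumClasses R _≈_ k → NumClasses R _≈_ l → k ≡ l
numClasses-unique {R = R} {_≈_} euclidean p q =
  ≤-antisym (numClasses-≤ {R = R} {_≈_} euclidean p q) (numClasses-≤ {R = R} {_≈_} euclidean q p)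

theorem4p4 : ∀ {n} (E : Digraph n) → StronglyConnected E → (s : Fin n) →
    (∀ m b p → CoeffB E s m b → CoeffP E s m p → b ≡ p) ×
    (∀ b r → CoeffB E s 0 b → NumRec E 0 r → b ≡ r) ×
    (∀ m b r r' → CoeffB E s (suc m) b → NumRec E (suc m) r → NumRec E m r' → b + r' ≡ r)
theorem4p4 E connected s =
  (λ m b p B P → numClasses-unique {R = λ c → SRecurrent c × SLevel c m} {_∼s_}
    (λ rc rd re → ∼s-euclidean (proj₁ rc) (proj₁ rd) (proj₁ re)) (B⇒P B) P) ,
  -- At level zero the raised classes are the empty family, since no successor equals zero.
  (λ b r B R → trans (sym (+-identityʳ b)) (numRec-unique (numRec-+ (B⇒P B) ((λ ()) , (λ ()) , (λ ()) , λ _ ())) R)) ,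
  λ m b r r' B R R' → numRec-unique (numRec-+ (B⇒P B)
    (numClasses-map {_≈_ = _∼_ E} (λ (rec , eq) → rec , cong suc eq) (λ (rec , eq) → rec , suc-injective eq) R')) R
  where
  open Sink E s
  open Bridge E connected s

  -- On s-recurrent configurations the two levels coincide, so the same representatives count both.
  B⇒P : ∀ {m b} → CoeffB E s m b → CoeffP E s m b
  B⇒P = numClasses-map {_≈_ = _∼s_}
    (λ (rec , level) → rec , classDLevel⇒slevel rec level)
    (λ (rec , level) → rec , slevel⇒classDLevel rec level)

  numRec-unique : ∀ {m k l} → NumRec E m k → NumRec E m l → k ≡ l
  numRec-unique {m} = numClasses-unique {R = λ c → Recurrent E c × total E c ≡ m} {_∼_ E}
    (λ rc _ _ → ∼-euclidean (proj₁ rc))
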